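{- Let $G$ be a connected non-bipartite graph and let $n\geq 6$ be an even integer. If $\kappa(G\times K_{2})>\frac{4}{n}\delta(G)$, then $G\times C_{n}$ is super-$\kappa$.
   Context: All graphs are simple. $C_n$ is the cycle on $n$ vertices and $K_2$ the complete graph on 2 vertices. The direct product $G\times H$ has vertex set $V(G)\times V(H)$, with $(u_1,v_1)(u_2,v_2)$ an edge iff $u_1u_2\in E(G)$ and $v_1v_2\in E(H)$. $\delta(G)$ is the minimum degree. For a non-complete graph $G$, the connectivity $\kappa(G)$ is the minimum size of a vertex set $S$ such that $G-S$ is disconnected; for a complete graph $\kappa(G)=|V(G)|-1$. A graph is super connected (super-$\kappa$) if every minimum vertex cut is the neighborhood of some vertex of minimum degree. -}

module Defs where

open import Data.Nat using (ℕ; zero; suc; _∸_; _≤_; _≡ᵇ_)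
open import Data.Bool using (Bool; true; false; _∨_; _∧_; not)
open import Data.Fin using (Fin; toℕ; remQuot)
open import Data.Fin.Subset using (Subset; _∉_; ⊥; ∣_∣)
open import Data.Vec using (tabulate)
open import Data.Product using (Σ; ∃; ∃-syntax; _×_; _,_)
open import Data.Sum using (_⊎_)
open import Relation.Nullary using (¬_)
open import Relation.Binary.PropositionalEquality using (_≡_; _≢_)

record Graph : Set where
  field
    order : ℕ
    adj   : Fin order → Fin order → Bool
open Graph public

IsSimple : Graph → Set
IsSimple G = (∀ u v → adj G u v ≡ adj G v u) × (∀ v → adj G v v ≡ false)

K₂ : Graph
K₂ = record { order = 2 ; adj = λ u v → not (toℕ u ≡ᵇ toℕ v) }

-- C_n : vertices 0..n-1, i ~ i+1 (mod n).  (A simple cycle for n ≥ 3.)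
cycNext : (n : ℕ) → Fin n → Fin n → Bool
cycNext n i j = (suc (toℕ i) ≡ᵇ toℕ j) ∨ ((suc (toℕ i) ≡ᵇ n) ∧ (toℕ j ≡ᵇ 0))

C : ℕ → Graph
C n = record { order = n ; adj = λ i j → cycNext n i j ∨ cycNext n j i }

_×ᴳ_ : Graph → Graph → Graph
G ×ᴳ H = record { order = order G Data.Nat.* order H ; adj = a }
  where
  open import Data.Nat
  open import Data.Product using (proj₁; proj₂)
  a : Fin (order G * order H) → Fin (order G * order H) → Bool
  a x y = adj G (proj₁ (remQuot {order G} (order H) x)) (proj₁ (remQuot {order G} (order H) y))
        ∧ adj H (proj₂ (remQuot {order G} (order H) x)) (proj₂ (remQuot {order G} (order H) y))

data Reach (G : Graph) (S : Subset (order G)) (u : Fin (order G)) : Fin (order G) → Set where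
  here : Reach G S u u
  step : ∀ {v w} → Reach G S u v → adj G v w ≡ true → w ∉ S → Reach G S u w

Connected : Graph → Set
Connected G = ∀ u v → Reach G ⊥ u v

Complete : Graph → Set
Complete G = ∀ u v → u ≢ v → adj G u v ≡ true

IsVertexCut : (G : Graph) → Subset (order G) → Set
IsVertexCut G S = Σ (Fin (order G)) λ u → Σ (Fin (order G)) λ v →
  u ∉ S × v ∉ S × ¬ Reach G S u v

IsConnectivity : Graph → ℕ → Set
IsConnectivity G k =
  (Complete G × k ≡ order G ∸ 1)
  ⊎ (¬ Complete G × (∃[ S ] (IsVertexCut G S × ∣ S ∣ ≡ k))
                  × (∀ S → IsVertexCut G S → k ≤ ∣ S ∣))

N : (G : Graph) → Fin (order G) → Subset (order G)
N G v = tabulate (adj G v)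

deg : (G : Graph) → Fin (order G) → ℕ
deg G v = ∣ N G v ∣

IsMinDegree : Graph → ℕ → Set
IsMinDegree G d = (∃[ v ] deg G v ≡ d) × (∀ v → d ≤ deg G v)

IsBipartite : Graph → Set
IsBipartite G = Σ (Fin (order G) → Bool) λ c → ∀ u v → adj G u v ≡ true → c u ≢ c v

SuperKappa : Graph → Set
SuperKappa G = ∀ S → IsVertexCut G S → (∀ T → IsVertexCut G T → ∣ S ∣ ≤ ∣ T ∣) →
  ∃[ v ] ((∀ w → deg G v ≤ deg G w) × S ≡ N G v)

{-# OPTIONS --safe #-}
-- Cut G × Cₙ into its n layers V(G) × {i}, let sᵢ be the number of vertices of
-- a minimum cut S in layer i, and note ∣S∣ ≤ 2d.  Two consecutive layers induce
-- G × K₂, and Σᵢ (sᵢ + sᵢ₊₁) = 2∣S∣ ≤ 4d < nk, so for some g layers g and g + 1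
-- remain connected to each other off S; call a layer reached if all its
-- vertices off S lie in that component.  A reached layer next to an unreached
-- one has sᵢ ≥ d, as every vertex has at least d neighbours in an adjacent
-- layer.  Suppose layer c is reached and layer c + 1 is not.  If layer c + 2 is
-- reached, then an unreached vertex of layer c + 1 is isolated, so its
-- neighbourhood is contained in S and equals S by minimality.  Otherwise the
-- block of unreached layers ends at a second reached layer with sᵢ ≥ d, which
-- exhausts S: layers c + 1 and c + 2 avoid S, hence are connected to each
-- other and to layer c, a contradiction.
module Submission where

open import Defs
open import Data.Nat using (ℕ; _*_; _<_; _≤_)
open import Data.Nat.Divisibility using (_∣_)
open import Relation.Nullary using (¬_)

open import Data.Bool using (Bool; true; false; _∧_; if_then_else_; T)
open import Data.Bool.Properties using (∨-comm; T-≡; T-∨; T-∧)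
open import Data.Fin using (Fin; zero; suc; toℕ; combine; quotient; remainder; _↑ˡ_; _↑ʳ_)
open import Data.Fin.Properties
  using (remQuot-combine; combine-remQuot; combine-injectiveʳ; any?; all?; toℕ-fromℕ<; toℕ<n; toℕ-injective)
open import Data.Fin.Subset using (Subset; _∈_; _∉_; _⊆_; _∪_; ⁅_⁆; ∣_∣; ⊤)
open import Data.Fin.Subset.Properties
  using (_∈?_; _⊆?_; p⊆q⇒∣p∣≤∣q∣; p⊂q⇒∣p∣<∣q∣; ⊆-antisym; ∣⊤∣≡n; ∈⊤; ∣⁅x⁆∣≡1; x∈⁅x⁆; x∈p∪q⁺)
open import Data.Nat using (zero; suc; _+_; _%_; _/_; _≤′_; ≤′-refl; ≤′-step; _≤?_; _<?_; z≤n; s≤s; _≡ᵇ_)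
open import Data.Nat.DivMod
  using (_mod_; m≡m%n+[m/n]*n; m%n<n; [m+n]%n≡m%n; m<n⇒m%n≡m; n%n≡0; %-distribˡ-+)
open import Data.Nat.Properties hiding (_≟_)
open import Data.Nat.Tactic.RingSolver using (solve-∀)
open import Data.Product using (∃-syntax; _×_; _,_; proj₁; proj₂)
open import Data.Sum using (_⊎_; inj₁; inj₂)
open import Data.Vec using ([]; _∷_; lookup; tabulate)
open import Data.Vec.Functional using (updateAt)
open import Data.Vec.Functional.Properties using (updateAt-minimal)
open import Data.Vec.Properties using (lookup∘tabulate; tabulate-cong; tabulate∘lookup; lookup⇒[]=; []=⇒lookup)
open import Function using (_∘_; const; Equivalence)
open import Relation.Binary.PropositionalEquality
open import Relation.Nullary using (yes; no; contradiction; ¬?; decidable-stable; ¬¬-excluded-middle)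
open import Relation.Nullary.Decidable using (_×-dec_; _→-dec_)
open import Relation.Unary using (Decidable)

open import Algebra.Properties.Semiring.Sum +-*-semiring
  using (sum; sum-syntax; sum-cong-≗; ∑-comm; ∑-distrib-+; *-distribˡ-sum; *-distribʳ-sum)

private
  variable
    m n k : ℕ

-- Finite sums

sum-mono : (f g : Fin n → ℕ) → (∀ i → f i ≤ g i) → sum f ≤ sum g
sum-mono {zero}  f g le = z≤n
sum-mono {suc n} f g le = +-mono-≤ (le zero) (sum-mono (f ∘ suc) (g ∘ suc) (le ∘ suc))

sum-const : ∀ n c → sum {n} (const c) ≡ n * c
sum-const zero    c = refl
sum-const (suc n) c = cong (c +_) (sum-const n c)

sum-↑ : ∀ m {n} (f : Fin (m + n) → ℕ) → sum f ≡ sum (λ i → f (i ↑ˡ n)) + sum (λ i → f (m ↑ʳ i))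
sum-↑ zero    f = refl
sum-↑ (suc m) f = trans (cong (f zero +_) (sum-↑ m (f ∘ suc))) (sym (+-assoc (f zero) _ _))

sum-combine : ∀ m (f : Fin (m * n) → ℕ) → sum f ≡ ∑[ u < m ] ∑[ i < n ] f (combine u i)
sum-combine         zero    f = refl
sum-combine {n = n} (suc m) f = trans (sum-↑ n f) (cong (sum (λ i → f (i ↑ˡ m * n)) +_) (sum-combine m (λ x → f (n ↑ʳ x))))

-- Both sides are the sum of `h` over 0, ..., n. When `h` has period n the end terms cancel, so a
-- sum over one turn of the cycle is invariant under a shift by one.
sum-shift : ∀ n (h : ℕ → ℕ) → h 0 + sum {n} (λ i → h (suc (toℕ i))) ≡ sum {n} (λ i → h (toℕ i)) + h n
sum-shift zero    h = +-identityʳ (h 0)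
sum-shift (suc n) h = trans (cong (h 0 +_) (sum-shift n (h ∘ suc))) (sym (+-assoc (h 0) _ _))

sum-extract : ∀ i (f : Fin n → ℕ) → sum f ≡ f i + sum (updateAt f i (const 0))
sum-extract zero    f = refl
sum-extract (suc i) f = trans (cong (f zero +_) (sum-extract i (f ∘ suc))) (swap (f zero) (f (suc i)) _)
  where
  swap : ∀ a b c → a + (b + c) ≡ b + (a + c)
  swap = solve-∀

-- Extract `f i`, then `f j`, then `f l`, overwriting each extracted entry by 0. Distinctness
-- ensures that the entries still to be extracted keep their values.
three-terms : ∀ (f : Fin n → ℕ) {i j l} → i ≢ j → i ≢ l → j ≢ l → f i + (f j + f l) ≤ sum f
three-terms f {i} {j} {l} i≢j i≢l j≢l = begin
  f i + (f j + f l)           ≡⟨ cong (f i +_) (cong₂ _+_ (updateAt-minimal j i f (i≢j ∘ sym)) f′l) ⟨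
  f i + (f₁ j + f₂ l)         ≤⟨ +-monoʳ-≤ (f i) (+-monoʳ-≤ (f₁ j) (≤-trans (m≤m+n (f₂ l) _) (≤-reflexive (sym (sum-extract l f₂))))) ⟩
  f i + (f₁ j + sum f₂)       ≡⟨ cong (f i +_) (sum-extract j f₁) ⟨
  f i + sum f₁                ≡⟨ sum-extract i f ⟨
  sum f                       ∎
  where
  open ≤-Reasoning
  f₁ = updateAt f i (const 0)
  f₂ = updateAt f₁ j (const 0)
  f′l : f₂ l ≡ f l
  f′l = trans (updateAt-minimal l j f₁ (j≢l ∘ sym)) (updateAt-minimal l i f (i≢l ∘ sym))

-- Subsets of finite sets

indicator : Bool → ℕ
indicator b = if b then 1 else 0

indicator-∧ : ∀ a b → indicator (a ∧ b) ≡ indicator a * indicator b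
indicator-∧ true  b = sym (+-identityʳ _)
indicator-∧ false b = refl

∣tabulate∣≡sum : (f : Fin n → Bool) → ∣ tabulate f ∣ ≡ sum (indicator ∘ f)
∣tabulate∣≡sum {zero}  f = refl
∣tabulate∣≡sum {suc n} f with f zero
... | true  = cong suc (∣tabulate∣≡sum (f ∘ suc))
... | false = ∣tabulate∣≡sum (f ∘ suc)

∈-tabulate⁺ : {f : Fin n → Bool} {i : Fin n} → f i ≡ true → i ∈ tabulate f
∈-tabulate⁺ {f = f} {i} eq = lookup⇒[]= i _ (trans (lookup∘tabulate f i) eq)

∈-tabulate⁻ : {f : Fin n → Bool} {i : Fin n} → i ∈ tabulate f → f i ≡ true
∈-tabulate⁻ {f = f} {i} i∈ = trans (sym (lookup∘tabulate f i)) ([]=⇒lookup i∈)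

∣p∣<∣q∣⇒∃∈q∉p : (p q : Subset n) → ∣ p ∣ < ∣ q ∣ → ∃[ x ] (x ∈ q × x ∉ p)
∣p∣<∣q∣⇒∃∈q∉p p q lt with any? (λ x → (x ∈? q) ×-dec ¬? (x ∈? p))
... | yes found = found
... | no  none  = contradiction lt (≤⇒≯ (p⊆q⇒∣p∣≤∣q∣ q⊆p))
  where
  q⊆p : q ⊆ p
  q⊆p {x} x∈q = decidable-stable (x ∈? p) (λ x∉p → none (x , x∈q , x∉p))

p⊆q∧∣q∣≤∣p∣⇒q≡p : (p q : Subset n) → p ⊆ q → ∣ q ∣ ≤ ∣ p ∣ → q ≡ p
p⊆q∧∣q∣≤∣p∣⇒q≡p p q p⊆q le = ⊆-antisym q⊆p p⊆q
  where
  q⊆p : q ⊆ p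
  q⊆p {x} x∈q = decidable-stable (x ∈? p) (λ x∉p → ≤⇒≯ le (p⊂q⇒∣p∣<∣q∣ (p⊆q , x , x∈q , x∉p)))

∣p∪q∣≤∣p∣+∣q∣ : (p q : Subset n) → ∣ p ∪ q ∣ ≤ ∣ p ∣ + ∣ q ∣
∣p∪q∣≤∣p∣+∣q∣ []          []          = z≤n
∣p∪q∣≤∣p∣+∣q∣ (true  ∷ p) (true  ∷ q) = s≤s (≤-trans (∣p∪q∣≤∣p∣+∣q∣ p q) (+-monoʳ-≤ ∣ p ∣ (n≤1+n ∣ q ∣)))
∣p∪q∣≤∣p∣+∣q∣ (true  ∷ p) (false ∷ q) = s≤s (∣p∪q∣≤∣p∣+∣q∣ p q)
∣p∪q∣≤∣p∣+∣q∣ (false ∷ p) (true  ∷ q) = subst (suc ∣ p ∪ q ∣ ≤_) (sym (+-suc ∣ p ∣ ∣ q ∣)) (s≤s (∣p∪q∣≤∣p∣+∣q∣ p q))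
∣p∪q∣≤∣p∣+∣q∣ (false ∷ p) (false ∷ q) = ∣p∪q∣≤∣p∣+∣q∣ p q

-- Layers of a subset of a product

layer : ∀ m → Subset (m * n) → Fin n → Subset m
layer m S i = tabulate (λ u → lookup S (combine u i))

∈-layer⁺ : (S : Subset (m * n)) {u : Fin m} {i : Fin n} → combine u i ∈ S → u ∈ layer m S i
∈-layer⁺ S = ∈-tabulate⁺ ∘ []=⇒lookup

∣S∣≡∑∣layer∣ : ∀ m n (S : Subset (m * n)) → ∣ S ∣ ≡ ∑[ i < n ] ∣ layer m S i ∣
∣S∣≡∑∣layer∣ m n S = begin
  ∣ S ∣                                                       ≡⟨ cong ∣_∣ (tabulate∘lookup S) ⟨
  ∣ tabulate (lookup S) ∣                                     ≡⟨ ∣tabulate∣≡sum (lookup S) ⟩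
  sum (indicator ∘ lookup S)                                  ≡⟨ sum-combine m (indicator ∘ lookup S) ⟩
  ∑[ u < m ] ∑[ i < n ] indicator (lookup S (combine u i))    ≡⟨ ∑-comm {m} {n} (λ u i → indicator (lookup S (combine u i))) ⟩
  ∑[ i < n ] ∑[ u < m ] indicator (lookup S (combine u i))    ≡⟨ sum-cong-≗ {n} (λ i → ∣tabulate∣≡sum (λ (u : Fin m) → lookup S (combine u i))) ⟨
  ∑[ i < n ] ∣ layer m S i ∣                                  ∎
  where open ≡-Reasoning

-- Finite search

-- Excluded middle holds under a double negation for a single proposition, and induction combines
-- finitely many instances. A proof of a contradiction may therefore assume that reachability is
-- decidable.
¬¬-Dec-Fin : (Q : Fin n → Set) → ¬ ¬ Decidable Q
¬¬-Dec-Fin {zero}  Q ¬dec = ¬dec λ ()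
¬¬-Dec-Fin {suc n} Q ¬dec = ¬¬-excluded-middle λ Q0? → ¬¬-Dec-Fin (Q ∘ suc) λ Q? →
  ¬dec λ { zero → Q0? ; (suc i) → Q? i }

-- Walk down from `b` until `Q` first holds; this happens at `a` at the latest. The bounds on `c`
-- are kept so that positions on a cycle stay within one turn.
last-before-failure : {Q : ℕ → Set} → Decidable Q → ∀ {a b} → a ≤′ b → Q a → ¬ Q b →
  ∃[ c ] (a ≤ c × c < b × Q c × ¬ Q (suc c))
last-before-failure Q? ≤′-refl Qa ¬Qb = contradiction Qa ¬Qb
last-before-failure Q? {b = suc b} (≤′-step a≤b) Qa ¬Qb with Q? b
... | yes Qb = b , ≤′⇒≤ a≤b , ≤-refl , Qb , ¬Qb
... | no ¬Qb′ with c , a≤c , c<b , Qc , ¬Qc⁺ ← last-before-failure Q? a≤b Qa ¬Qb′ =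
  c , a≤c , m≤n⇒m≤1+n c<b , Qc , ¬Qc⁺

-- Graphs and their direct products

Reach-trans : ∀ {G S u v w} → Reach G S u v → Reach G S v w → Reach G S u w
Reach-trans r here           = r
Reach-trans r (step s e w∉S) = step (Reach-trans r s) e w∉S

-- `Reach` tests only the vertices it enters, never its start. Reversal makes the old start an
-- entered vertex, hence the condition `u ∉ S`.
Reach-sym : ∀ {G S u v} → (∀ x y → adj G x y ≡ adj G y x) → u ∉ S → Reach G S u v → Reach G S v u
Reach-sym         adj-sym u∉S here = here
Reach-sym {G} {S} adj-sym u∉S (step {v} {w} r e w∉S) =
  Reach-trans (step here (trans (adj-sym w v) e) (v∉S r)) (Reach-sym adj-sym u∉S r)
  where
  v∉S : ∀ {v} → Reach G S _ v → v ∉ S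
  v∉S here           = u∉S
  v∉S (step _ _ v∉S) = v∉S

-- The first step of any walk from `x` enters the deleted set `N G x`, so `x` reaches nothing but
-- itself.
N-isVertexCut : ∀ G {x y} → adj G x x ≡ false → adj G x y ≡ false → x ≢ y → IsVertexCut G (N G x)
N-isVertexCut G {x} {y} xx xy x≢y = x , y , ∉N xx , ∉N xy , λ r → x≢y (sym (stuck r))
  where
  ∉N : ∀ {z} → adj G x z ≡ false → z ∉ N G x
  ∉N xz z∈N with () ← trans (sym xz) (∈-tabulate⁻ z∈N)
  stuck : ∀ {z} → Reach G (N G x) x z → z ≡ x
  stuck here = refl
  stuck (step r e z∉N) with refl ← stuck r = contradiction (∈-tabulate⁺ e) z∉N

module _ (G H : Graph) where

  adj-combine : ∀ u i w j → adj (G ×ᴳ H) (combine u i) (combine w j) ≡ adj G u w ∧ adj H i j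
  adj-combine u i w j = cong₂ (λ p q → adj G (proj₁ p) (proj₁ q) ∧ adj H (proj₂ p) (proj₂ q))
    (remQuot-combine u i) (remQuot-combine w j)

  -- The indicator of adjacency factors over the two coordinates, so the double sum counting
  -- neighbours splits into a product.
  deg-product : ∀ u i → deg (G ×ᴳ H) (combine u i) ≡ deg G u * deg H i
  deg-product u i = begin
    deg (G ×ᴳ H) (combine u i)                                            ≡⟨ ∣tabulate∣≡sum (adj (G ×ᴳ H) (combine u i)) ⟩
    sum (indicator ∘ adj (G ×ᴳ H) (combine u i))                          ≡⟨ sum-combine (order G) _ ⟩
    ∑[ w < order G ] ∑[ j < order H ] indicator (adj (G ×ᴳ H) (combine u i) (combine w j))
      ≡⟨ sum-cong-≗ (λ w → sum-cong-≗ (λ j → trans (cong indicator (adj-combine u i w j)) (indicator-∧ (adj G u w) _))) ⟩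
    ∑[ w < order G ] ∑[ j < order H ] (indicator (adj G u w) * indicator (adj H i j))
      ≡⟨ sum-cong-≗ (λ w → *-distribˡ-sum (indicator (adj G u w)) (indicator ∘ adj H i)) ⟨
    ∑[ w < order G ] (indicator (adj G u w) * sum (indicator ∘ adj H i))  ≡⟨ *-distribʳ-sum (sum (indicator ∘ adj H i)) (indicator ∘ adj G u) ⟨
    sum (indicator ∘ adj G u) * sum (indicator ∘ adj H i)                 ≡⟨ cong₂ _*_ (∣tabulate∣≡sum (adj G u)) (∣tabulate∣≡sum (adj H i)) ⟨
    deg G u * deg H i                                                     ∎
    where open ≡-Reasoning

  -- Distinct copies of one vertex of a loopless G are never adjacent.
  N-product-isVertexCut : (∀ v → adj G v v ≡ false) → ∀ u {i j} → i ≢ j → IsVertexCut (G ×ᴳ H) (N (G ×ᴳ H) (combine u i))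
  N-product-isVertexCut irr u {i} {j} i≢j =
    N-isVertexCut (G ×ᴳ H) (copies i) (copies j) (i≢j ∘ combine-injectiveʳ u i u j)
    where
    copies : ∀ l → adj (G ×ᴳ H) (combine u i) (combine u l) ≡ false
    copies l = trans (adj-combine u i u l) (cong (_∧ adj H i l) (irr u))

  product-sym : (∀ u v → adj G u v ≡ adj G v u) → (∀ i j → adj H i j ≡ adj H j i) →
    ∀ x y → adj (G ×ᴳ H) x y ≡ adj (G ×ᴳ H) y x
  product-sym symG symH x y = cong₂ _∧_ (symG _ _) (symH _ _)

-- The layers over the ends i, j of an edge of H carry a copy of G × K₂.
module _ (G H : Graph) (S : Subset (order G * order H)) {i j : Fin (order H)}
  (ij : adj H i j ≡ true) (ji : adj H j i ≡ true)
  where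

  private
    end : Fin 2 → Fin (order H)
    end zero    = i
    end (suc _) = j

    φ : Fin (order G * 2) → Fin (order G * order H)
    φ z = combine (quotient {order G} 2 z) (end (remainder {order G} 2 z))

    φ-combine : ∀ (u : Fin (order G)) b → φ (combine u b) ≡ combine u (end b)
    φ-combine u b = cong (λ (p : Fin (order G) × Fin 2) → combine (proj₁ p) (end (proj₂ p))) (remQuot-combine u b)

    φ⁻¹S : Subset (order G * 2)
    φ⁻¹S = tabulate (lookup S ∘ φ)

    layer-φ⁻¹S : ∀ b → layer (order G) φ⁻¹S b ≡ layer (order G) S (end b)
    layer-φ⁻¹S b = tabulate-cong λ u → trans (lookup∘tabulate (lookup S ∘ φ) (combine u b)) (cong (lookup S) (φ-combine u b))

    ∣φ⁻¹S∣ : ∣ φ⁻¹S ∣ ≡ ∣ layer (order G) S i ∣ + ∣ layer (order G) S j ∣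
    ∣φ⁻¹S∣ = trans (∣S∣≡∑∣layer∣ (order G) 2 φ⁻¹S)
      (cong₂ _+_ (cong ∣_∣ (layer-φ⁻¹S zero)) (trans (+-identityʳ _) (cong ∣_∣ (layer-φ⁻¹S (suc zero)))))

    end-adj : ∀ a b → adj K₂ a b ≡ true → adj H (end a) (end b) ≡ true
    end-adj zero       (suc zero) _ = ij
    end-adj (suc zero) zero       _ = ji
    end-adj (suc zero) (suc zero) ()

    ∧-true : ∀ {a b} → a ∧ b ≡ true → a ≡ true × b ≡ true
    ∧-true {true} {true} _ = refl , refl

    φ-Reach : ∀ {y z} → Reach (G ×ᴳ K₂) φ⁻¹S y z → Reach (G ×ᴳ H) S (φ y) (φ z)
    φ-Reach here = here
    φ-Reach (step {v} {w} r e w∉) with eG , eK ← ∧-true e =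
      step (φ-Reach r)
        (trans (adj-combine G H _ (end (remainder {order G} 2 v)) _ (end (remainder {order G} 2 w))) (cong₂ _∧_ eG (end-adj _ _ eK)))
        (w∉ ∘ ∈-tabulate⁺ ∘ []=⇒lookup)

  -- The pullback of `S` to G × K₂ has fewer than `k` elements, so it is not a cut, and walks
  -- avoiding it map to walks avoiding `S`. Not being a cut refutes only unreachability, hence the
  -- double negation.
  adjacent-layers-connected : (∀ T → IsVertexCut (G ×ᴳ K₂) T → k ≤ ∣ T ∣) →
    ∣ layer (order G) S i ∣ + ∣ layer (order G) S j ∣ < k →
    ∀ {u w : Fin (order G)} → combine u i ∉ S → combine w i ∉ S → ¬ ¬ Reach (G ×ᴳ H) S (combine u i) (combine w i)
  adjacent-layers-connected cut≥k few {u} {w} u∉S w∉S ¬r =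
    <⇒≱ (subst (_< _) (sym ∣φ⁻¹S∣) few)
      (cut≥k φ⁻¹S (combine u zero , combine w zero , off u∉S , off w∉S ,
        ¬r ∘ subst₂ (Reach (G ×ᴳ H) S) (φ-combine u zero) (φ-combine w zero) ∘ φ-Reach))
    where
    off : ∀ {u : Fin (order G)} → combine u i ∉ S → combine u zero ∉ φ⁻¹S
    off {u} u∉S z∈ = u∉S (subst (_∈ S) (φ-combine u zero) (lookup⇒[]= _ S (∈-tabulate⁻ z∈)))

deg<order : ∀ G → (∀ v → adj G v v ≡ false) → ∀ v → deg G v < order G
deg<order G irr v = subst (deg G v <_) (∣⊤∣≡n (order G)) (p⊂q⇒∣p∣<∣q∣ ((λ _ → ∈⊤) , v , ∈⊤ , v∉N))
  where
  v∉N : v ∉ N G v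
  v∉N v∈N with () ← trans (sym (irr v)) (∈-tabulate⁻ v∈N)

-- Cycles

module Cycle (n-1 : ℕ) where

  private
    n′ : ℕ
    n′ = suc n-1

  opaque
    -- Positions on the cycle are indexed by all natural numbers modulo n, so that an interval
    -- running past the last vertex remains an ordinary interval.
    at : ℕ → Fin n′
    at p = p mod n′

    toℕ-at : ∀ p → toℕ (at p) ≡ p % n′
    toℕ-at p = toℕ-fromℕ< (m%n<n p n′)

  at-≡ : ∀ {p q} → p % n′ ≡ q % n′ → at p ≡ at q
  at-≡ {p} {q} eq = toℕ-injective (trans (toℕ-at p) (trans eq (sym (toℕ-at q))))

  ≡-at : ∀ {p q} → at p ≡ at q → p % n′ ≡ q % n′
  ≡-at {p} {q} eq = trans (sym (toℕ-at p)) (trans (cong toℕ eq) (toℕ-at q))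

  at-toℕ : ∀ i → at (toℕ i) ≡ i
  at-toℕ i = toℕ-injective (trans (toℕ-at (toℕ i)) (m<n⇒m%n≡m (toℕ<n i)))

  at-+n : ∀ p → at (p + n′) ≡ at p
  at-+n p = at-≡ ([m+n]%n≡m%n p n′)

  private
    %-+ : ∀ {p q} r → p % n′ ≡ q % n′ → (p + r) % n′ ≡ (q + r) % n′
    %-+ {p} {q} r eq = trans (%-distribˡ-+ p r n′)
      (trans (cong (λ x → (x + r % n′) % n′) eq) (sym (%-distribˡ-+ q r n′)))

  at-suc : ∀ {p q} → at p ≡ at q → at (suc p) ≡ at (suc q)
  at-suc {p} {q} eq = at-≡ (subst₂ (λ x y → x % n′ ≡ y % n′) (+-comm p 1) (+-comm q 1) (%-+ {p} {q} 1 (≡-at eq)))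

  -- Adding n - 1 more turns a successor into a full turn, which is invisible modulo n.
  at-suc-injective : ∀ {p q} → at (suc p) ≡ at (suc q) → at p ≡ at q
  at-suc-injective {p} {q} eq = trans (sym (at-+n p)) (trans (at-≡ shifted) (at-+n q))
    where
    shifted : (p + n′) % n′ ≡ (q + n′) % n′
    shifted = subst₂ (λ x y → x % n′ ≡ y % n′) (sym (+-suc p n-1)) (sym (+-suc q n-1))
      (%-+ {suc p} {suc q} n-1 (≡-at eq))

  -- With equal residues, `p < q` forces a larger quotient for `q`, which puts `q` at least a full
  -- turn ahead.
  at-distinct : ∀ {p q} → p < q → q < p + n′ → at p ≢ at q
  at-distinct {p} {q} p<q q<p+n eq = <⇒≱ q<p+n (begin
    p + n′                   ≡⟨ cong (_+ n′) (m≡m%n+[m/n]*n p n′) ⟩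
    x + a * n′ + n′          ≡⟨ regroup x (a * n′) n′ ⟩
    x + suc a * n′           ≤⟨ +-monoʳ-≤ x (*-monoˡ-≤ n′ a<b) ⟩
    x + b * n′               ≡⟨ q≡ ⟨
    q                        ∎)
    where
    open ≤-Reasoning
    x = p % n′
    a = p / n′
    b = q / n′
    regroup : ∀ x y z → x + y + z ≡ x + (z + y)
    regroup = solve-∀
    q≡ : q ≡ x + b * n′
    q≡ = trans (m≡m%n+[m/n]*n q n′) (cong (_+ b * n′) (sym (≡-at eq)))
    a<b : a < b
    a<b = *-cancelʳ-< n′ a b (+-cancelˡ-< x (a * n′) (b * n′)
      (subst₂ _<_ (m≡m%n+[m/n]*n p n′) q≡ p<q))

  private
    cycNext⇒at : ∀ {i j} → T (cycNext n′ i j) → j ≡ at (suc (toℕ i))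
    cycNext⇒at {i} {j} t with Equivalence.to (T-∨ {suc (toℕ i) ≡ᵇ toℕ j}) t
    ... | inj₁ inner = trans (sym (at-toℕ j)) (cong at (sym (≡ᵇ⇒≡ (suc (toℕ i)) (toℕ j) inner)))
    ... | inj₂ wrap with i-last , j-first ← Equivalence.to T-∧ wrap =
      trans (sym (at-toℕ j)) (trans (cong at (≡ᵇ⇒≡ (toℕ j) 0 j-first))
        (trans (sym (at-+n 0)) (cong at (sym (≡ᵇ⇒≡ (suc (toℕ i)) n′ i-last)))))

    at⇒cycNext : ∀ i → T (cycNext n′ i (at (suc (toℕ i))))
    at⇒cycNext i with suc (toℕ i) <? n′
    ... | yes i+1<n = Equivalence.from T-∨ (inj₁ (≡⇒≡ᵇ _ _ (sym (trans (toℕ-at (suc (toℕ i))) (m<n⇒m%n≡m i+1<n)))))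
    ... | no  i+1≮n = Equivalence.from T-∨ (inj₂ (Equivalence.from T-∧
      (≡⇒≡ᵇ _ _ i+1≡n , ≡⇒≡ᵇ _ _ (trans (toℕ-at (suc (toℕ i))) (trans (cong (_% n′) i+1≡n) (n%n≡0 n′))))))
      where
      i+1≡n : suc (toℕ i) ≡ n′
      i+1≡n = ≤-antisym (toℕ<n i) (≮⇒≥ i+1≮n)

  C-sym : ∀ i j → adj (C n′) i j ≡ adj (C n′) j i
  C-sym i j = ∨-comm (cycNext n′ i j) (cycNext n′ j i)

  C-next : ∀ p → adj (C n′) (at p) (at (suc p)) ≡ true
  C-next p = Equivalence.to T-≡ (Equivalence.from (T-∨ {cycNext n′ (at p) (at (suc p))}) (inj₁
    (subst (λ j → T (cycNext n′ (at p) j)) (at-suc (at-toℕ (at p))) (at⇒cycNext (at p)))))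

  C-prev : ∀ p → adj (C n′) (at (suc p)) (at p) ≡ true
  C-prev p = trans (C-sym (at (suc p)) (at p)) (C-next p)

  -- Centring at `suc p` names the predecessor as `at p` without subtraction.
  C-neighbours : ∀ p {j} → adj (C n′) (at (suc p)) j ≡ true → j ≡ at p ⊎ j ≡ at (suc (suc p))
  C-neighbours p {j} e with Equivalence.to (T-∨ {cycNext n′ (at (suc p)) j}) (Equivalence.from T-≡ e)
  ... | inj₁ forward  = inj₂ (trans (cycNext⇒at forward) (at-suc (at-toℕ (at (suc p)))))
  ... | inj₂ backward = inj₁ (sym (trans (at-suc-injective (cycNext⇒at backward)) (at-toℕ j)))

  deg-C≤2 : ∀ p → deg (C n′) (at (suc p)) ≤ 2
  deg-C≤2 p = begin
    deg (C n′) (at (suc p))                  ≤⟨ p⊆q⇒∣p∣≤∣q∣ {p = N (C n′) (at (suc p))} {q = ⁅ at p ⁆ ∪ ⁅ at (2 + p) ⁆} N⊆ ⟩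
    ∣ ⁅ at p ⁆ ∪ ⁅ at (2 + p) ⁆ ∣            ≤⟨ ∣p∪q∣≤∣p∣+∣q∣ ⁅ at p ⁆ ⁅ at (2 + p) ⁆ ⟩
    ∣ ⁅ at p ⁆ ∣ + ∣ ⁅ at (2 + p) ⁆ ∣        ≡⟨ cong₂ _+_ (∣⁅x⁆∣≡1 (at p)) (∣⁅x⁆∣≡1 (at (2 + p))) ⟩
    2                                        ∎
    where
    open ≤-Reasoning
    N⊆ : N (C n′) (at (suc p)) ⊆ ⁅ at p ⁆ ∪ ⁅ at (2 + p) ⁆
    N⊆ {j} j∈N with C-neighbours p {j} (∈-tabulate⁻ {f = adj (C n′) (at (suc p))} j∈N)
    ... | inj₁ j≡ = x∈p∪q⁺ (inj₁ (subst (_∈ ⁅ at p ⁆) (sym j≡) (x∈⁅x⁆ (at p))))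
    ... | inj₂ j≡ = x∈p∪q⁺ (inj₂ (subst (_∈ ⁅ at (2 + p) ⁆) (sym j≡) (x∈⁅x⁆ (at (2 + p)))))

-- Cuts of G × Cₙ

module _ (G : Graph) (simple : IsSimple G) (n-1 : ℕ)
  (S : Subset (order G * suc n-1)) (k d : ℕ)
  (d≤deg : ∀ v → d ≤ deg G v) (k≤d : k ≤ d)
  (k≤cut : ∀ T → IsVertexCut (G ×ᴳ K₂) T → k ≤ ∣ T ∣)
  (∣S∣≤2d : ∣ S ∣ ≤ d + d) (2∣S∣<nk : ∣ S ∣ + ∣ S ∣ < suc n-1 * k)
  where

  open Cycle n-1

  private
    n′ : ℕ
    n′ = suc n-1

    H : Graph
    H = G ×ᴳ C n′

    s : Fin n′ → ℕ
    s i = ∣ layer (order G) S i ∣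

    ∑s : sum s ≡ ∣ S ∣
    ∑s = sym (∣S∣≡∑∣layer∣ (order G) n′ S)

    -- Averaging: if each of the n consecutive pairs of layers held at least `k` vertices of `S`,
    -- counting every layer twice would give nk ≤ 2∣S∣.
    sparse-layers : ∃[ g ] (g < n′ × s (at g) + s (at (suc g)) < k)
    sparse-layers with any? (λ (i : Fin n′) → s (at (toℕ i)) + s (at (suc (toℕ i))) <? k)
    ... | yes (i , lt) = toℕ i , toℕ<n i , lt
    ... | no  none     = contradiction 2∣S∣<nk (≤⇒≯ (begin
      n′ * k                                                ≡⟨ sum-const n′ k ⟨
      sum {n′} (const k)                                    ≤⟨ sum-mono {n′} _ _ (λ i → ≮⇒≥ (λ lt → none (i , lt))) ⟩
      ∑[ i < n′ ] (h (toℕ i) + h (suc (toℕ i)))             ≡⟨ ∑-distrib-+ {n′} (h ∘ toℕ) (h ∘ suc ∘ toℕ) ⟩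
      sum {n′} (h ∘ toℕ) + sum {n′} (h ∘ suc ∘ toℕ)         ≡⟨ cong₂ _+_ ∑h (trans ∑h⁺ ∑h) ⟩
      ∣ S ∣ + ∣ S ∣                                         ∎))
      where
      open ≤-Reasoning
      h : ℕ → ℕ
      h p = s (at p)
      ∑h : sum {n′} (h ∘ toℕ) ≡ ∣ S ∣
      ∑h = trans (sum-cong-≗ {n′} (λ i → cong s (at-toℕ i))) ∑s
      ∑h⁺ : sum {n′} (h ∘ suc ∘ toℕ) ≡ sum {n′} (h ∘ toℕ)
      -- The end terms `h 0` and `h n′` agree because `at` has period n.
      ∑h⁺ = +-cancelˡ-≡ (h 0) _ _ (trans (sum-shift n′ h)
        (trans (cong (sum {n′} (h ∘ toℕ) +_) (cong s (at-+n 0))) (+-comm _ (h 0))))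

    off-S : ∀ B i → s i < ∣ B ∣ → ∃[ u ] (u ∈ B × combine u i ∉ S)
    off-S B i lt with u , u∈B , u∉ ← ∣p∣<∣q∣⇒∃∈q∉p (layer (order G) S i) B lt =
      u , u∈B , u∉ ∘ ∈-layer⁺ S

    edge : ∀ {u w i j} → adj G u w ≡ true → adj (C n′) i j ≡ true → adj H (combine u i) (combine w j) ≡ true
    edge uw ij = trans (adj-combine G (C n′) _ _ _ _) (cong₂ _∧_ uw ij)

    ∈N-sym : ∀ {u w} → u ∈ N G w → adj G u w ≡ true
    ∈N-sym {u} {w} u∈N = trans (proj₁ simple u w) (∈-tabulate⁻ u∈N)

    pair-connected : ∀ p → s (at p) + s (at (suc p)) < k → ∀ {u w : Fin (order G)} →
      combine u (at p) ∉ S → combine w (at p) ∉ S → ¬ ¬ Reach H S (combine u (at p)) (combine w (at p))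
    pair-connected p = adjacent-layers-connected G (C n′) S (C-next p) (C-prev p) k≤cut

    -- Spreading reachability around the cycle from a sparse pair of layers

    module _ (no-isolated : ∀ x → ¬ N H x ⊆ S) (g : ℕ) (g<n : g < n′)
      (sparse : s (at g) + s (at (suc g)) < k)
      {a : Fin (order G)} (a∉S : combine a (at g) ∉ S) (reach? : Decidable (Reach H S (combine a (at g))))
      where

      -- A layer contained in `S` counts as reached.
      Reached : Fin n′ → Set
      Reached i = ∀ (u : Fin (order G)) → combine u i ∉ S → Reach H S (combine a (at g)) (combine u i)

      Reached? : Decidable Reached
      Reached? i = all? λ u → ¬? (combine u i ∈? S) →-dec reach? (combine u i)

      -- The sparse pair connects all vertices of layer p off `S` to one another, so one reached
      -- vertex brings in the rest.
      Reached-if : ∀ p → s (at p) + s (at (suc p)) < k → ∀ {w : Fin (order G)} → combine w (at p) ∉ S →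
        Reach H S (combine a (at g)) (combine w (at p)) → Reached (at p)
      Reached-if p few w∉S r u u∉S = decidable-stable (reach? (combine u (at p)))
        λ ¬r → pair-connected p few w∉S u∉S (¬r ∘ Reach-trans r)

      Reached-g : Reached (at g)
      Reached-g = Reached-if g sparse a∉S here

      -- If layer i held fewer than `d` vertices of `S`, every vertex of layer j off `S` would have
      -- a surviving neighbour in layer i, which is reached, and so would be reached itself.
      heavy : ∀ {i j} → adj (C n′) i j ≡ true → Reached i → ¬ Reached j → d ≤ s i
      heavy {i} ij Ri ¬Rj = ≮⇒≥ λ lt → ¬Rj λ w w∉S →
        let u , u∈N , u∉S = off-S (N G w) i (<-≤-trans lt (d≤deg w))
        in step (Ri u u∉S) (edge (∈N-sym u∈N) ij) w∉S

      -- All neighbours of a vertex in layer c + 1 lie in layers c and c + 2. One off `S` would be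
      -- reached and pass this on, so an unreached vertex has its whole neighbourhood in `S`,
      -- against `no-isolated`.
      ¬gap : ∀ c → ¬ Reached (at (suc c)) → ¬ (Reached (at c) × Reached (at (2 + c)))
      ¬gap c ¬R (Rc , Rc+2) = ¬R λ w w∉S → decidable-stable (reach? _) λ ¬r →
        no-isolated (combine w (at (suc c))) λ {x} → N⊆S w w∉S ¬r x
        where
        N⊆S : ∀ (w : Fin (order G)) → combine w (at (suc c)) ∉ S → ¬ Reach H S (combine a (at g)) (combine w (at (suc c))) →
          ∀ x → x ∈ N H (combine w (at (suc c))) → x ∈ S
        N⊆S w w∉S ¬r x x∈N = decidable-stable (x ∈? S) (λ x∉S → ¬r (step (reached x∉S) back w∉S))
          where
          u = quotient {order G} n′ x
          j = remainder {order G} n′ x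
          x≡ : combine u j ≡ x
          x≡ = combine-remQuot {order G} n′ x
          fwd : adj G w u ∧ adj (C n′) (at (suc c)) j ≡ true
          fwd = trans (sym (adj-combine G (C n′) w (at (suc c)) u j))
            (trans (cong (adj H (combine w (at (suc c)))) x≡) (∈-tabulate⁻ x∈N))
          back : adj H x (combine w (at (suc c))) ≡ true
          back = trans (product-sym G (C n′) (proj₁ simple) C-sym x _) (∈-tabulate⁻ x∈N)
          R-j : Reached j
          R-j with adj G w u | fwd
          ... | true | cj with C-neighbours c cj
          ... | inj₁ j≡ = subst Reached (sym j≡) Rc
          ... | inj₂ j≡ = subst Reached (sym j≡) Rc+2
          reached : x ∉ S → Reach H S (combine a (at g)) x
          reached x∉S = subst (Reach H S _) x≡ (R-j u (x∉S ∘ subst (_∈ S) x≡))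

      -- By `heavy` the layers c and t + 1 hold `d` vertices of `S` each, which uses up all 2d.
      -- Hence layers c + 1 and c + 2, which lie between them, avoid `S` and form a sparse pair, and
      -- an edge from layer c makes layer c + 1 reached.
      ¬block : ∀ c t → g ≤ c → 2 + c ≤ t → t < g + n′ → Reached (at c) → ¬ Reached (at (suc c)) →
        ¬ Reached (at t) → ¬ Reached (at (suc t))
      ¬block c t g≤c 2+c≤t t<g+n Rc ¬Rc+1 ¬Rt Rt+1 =
        -- Layer c has at most `d` vertices of `S`, fewer than G has vertices, so some `u` survives
        -- there. Layer c + 1 avoids `S`, so a neighbour `w` of `u` survives as well.
        let u , _ , u∉S = off-S ⊤ (at c) (≤-<-trans sc≤d d<∣⊤∣)
            w , w∈N , w∉S = off-S (N G u) (at (suc c)) (subst (_< deg G u) (sym sc+1≡0) (<-≤-trans 0<d (d≤deg u)))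
        in ¬Rc+1 (Reached-if (suc c) (subst (_< k) (sym (cong₂ _+_ sc+1≡0 sc+2≡0)) 0<k) w∉S
             (step (Rc u u∉S) (edge (∈-tabulate⁻ w∈N) (C-next c)) w∉S))
        where
        0<k : 0 < k
        0<k = ≤-<-trans z≤n sparse

        0<d : 0 < d
        0<d = <-≤-trans 0<k k≤d

        d<∣⊤∣ : d < ∣ ⊤ {order G} ∣
        d<∣⊤∣ = subst (d <_) (sym (∣⊤∣≡n (order G))) (≤-<-trans (d≤deg a) (deg<order G (proj₂ simple) a))

        d≤sc : d ≤ s (at c)
        d≤sc = heavy (C-next c) Rc ¬Rc+1

        d≤st+1 : d ≤ s (at (suc t))
        d≤st+1 = heavy (C-prev t) Rt+1 ¬Rt

        -- Layer g holds fewer than k ≤ d vertices of `S` and cannot be heavy. Thus g < c, which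
        -- leaves t + 1 strictly less than a full turn past c: the two ends of the block are
        -- different layers.
        g≢c : g ≢ c
        g≢c refl = <⇒≱ (≤-<-trans (m≤m+n (s (at g)) _) sparse) (≤-trans k≤d d≤sc)

        t+1<c+n : suc t < c + n′
        t+1<c+n = ≤-<-trans t<g+n (+-monoˡ-< n′ (≤∧≢⇒< g≤c g≢c))

        exhausted : ∀ {r} → c < r → r ≤ t → s (at c) + (s (at (suc t)) + s (at r)) ≤ d + d
        exhausted {r} c<r r≤t = ≤-trans
          (three-terms s
            (at-distinct (m≤n⇒m≤1+n (<-≤-trans c<r r≤t)) t+1<c+n)
            (at-distinct c<r (<-trans (s≤s r≤t) t+1<c+n))
            (at-distinct (s≤s r≤t) (<-trans t+1<c+n (+-monoˡ-< n′ c<r)) ∘ sym))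
          (≤-trans (≤-reflexive ∑s) ∣S∣≤2d)

        empty : ∀ {r} → c < r → r ≤ t → s (at r) ≡ 0
        empty {r} c<r r≤t = n≤0⇒n≡0 (+-cancelˡ-≤ d _ _ (+-cancelˡ-≤ d _ _ (begin
          d + (d + s (at r))                          ≤⟨ +-mono-≤ d≤sc (+-monoˡ-≤ (s (at r)) d≤st+1) ⟩
          s (at c) + (s (at (suc t)) + s (at r))      ≤⟨ exhausted c<r r≤t ⟩
          d + d                                       ≡⟨ cong (d +_) (+-identityʳ d) ⟨
          d + (d + 0)                                 ∎)))
          where open ≤-Reasoning

        sc+1≡0 : s (at (suc c)) ≡ 0
        sc+1≡0 = empty ≤-refl (<⇒≤ 2+c≤t)

        sc+2≡0 : s (at (2 + c)) ≡ 0
        sc+2≡0 = empty (n≤1+n (suc c)) 2+c≤t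

        sc≤d : s (at c) ≤ d
        sc≤d = +-cancelʳ-≤ d _ _ (≤-trans
          (+-monoʳ-≤ (s (at c)) (≤-trans d≤st+1 (m≤m+n _ _)))
          (exhausted ≤-refl (<⇒≤ 2+c≤t)))

      all-Reached : ∀ i → Reached i
      all-Reached i = decidable-stable (Reached? i) λ ¬Ri →
        let p , g≤p , p<g+n , p≡i = index
            c , g≤c , c<p , Rc , ¬Rc+1 = last-before-failure (Reached? ∘ at) (≤⇒≤′ g≤p) Reached-g
              (¬Ri ∘ subst Reached p≡i)
            -- By `¬gap` the block contains layer c + 2. Since g + n is layer g again, a second
            -- search, with the negated predicate, finds a return to a reached layer.
            ¬Rc+2 = λ Rc+2 → ¬gap c ¬Rc+1 (Rc , Rc+2)
            t , 2+c≤t , t<g+n , ¬Rt , ¬¬Rt+1 = last-before-failure (¬? ∘ Reached? ∘ at)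
              (≤⇒≤′ (≤-trans (s≤s c<p) p<g+n)) ¬Rc+2 (λ ¬R → ¬R (subst Reached (sym (at-+n g)) Reached-g))
        in ¬¬Rt+1 (¬block c t g≤c 2+c≤t t<g+n Rc ¬Rc+1 ¬Rt)
        where
        -- Represents `i` inside the window [g, g + n), one turn starting at the reached layer g.
        index : ∃[ p ] (g ≤ p × p < g + n′ × at p ≡ i)
        index with g ≤? toℕ i
        ... | yes g≤i = toℕ i , g≤i , <-≤-trans (toℕ<n i) (m≤n+m n′ g) , at-toℕ i
        ... | no  g≰i = toℕ i + n′ , ≤-trans (<⇒≤ g<n) (m≤n+m n′ (toℕ i)) , +-monoˡ-< n′ (≰⇒> g≰i) ,
          trans (at-+n (toℕ i)) (at-toℕ i)

  -- The conclusion is decidable, so reachability may be decided under a double negation.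
  cut-isolates : IsVertexCut H S → ∃[ x ] N H x ⊆ S
  cut-isolates (y , z , y∉S , z∉S , ¬r) with any? (λ x → N H x ⊆? S)
  ... | yes found = found
  ... | no  none with g , g<n , sparse ← sparse-layers = contradiction reach? (¬¬-Dec-Fin _)
    where
    v = quotient {order G} n′ y
    -- The at least `d` neighbours of `v` outnumber the fewer than k ≤ d vertices of `S` in layer g,
    -- so one of them gives a starting vertex off `S`.
    start = off-S (N G v) (at g) (<-≤-trans (≤-<-trans (m≤m+n _ _) sparse) (≤-trans k≤d (d≤deg v)))
    a = combine (proj₁ start) (at g)
    a∉S = proj₂ (proj₂ start)
    reach? : ¬ Decidable (Reach H S a)
    reach? dec = ¬r (Reach-trans (Reach-sym (product-sym G (C n′) (proj₁ simple) C-sym) a∉S (R y∉S)) (R z∉S))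
      where
      R : ∀ {x} → x ∉ S → Reach H S a x
      R {x} x∉S = subst (Reach H S a) x≡ (all-Reached (λ x N⊆S → none (x , N⊆S)) g g<n sparse a∉S dec
          (remainder {order G} n′ x) (quotient {order G} n′ x) (x∉S ∘ subst (_∈ S) x≡))
        where
        x≡ : combine (quotient {order G} n′ x) (remainder {order G} n′ x) ≡ x
        x≡ = combine-remQuot {order G} n′ x

-- Numerical bounds and the conclusion

connectivity-≤-cut : ∀ G → (∀ v → adj G v v ≡ false) → ∀ {k} → IsConnectivity (G ×ᴳ K₂) k →
  ∀ T → IsVertexCut (G ×ᴳ K₂) T → k ≤ ∣ T ∣
connectivity-≤-cut G irr (inj₂ (_ , _ , k≤)) = k≤
-- A cut supplies a vertex, and the two copies of its G-coordinate are distinct and non-adjacent, so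
-- the product is not complete.
connectivity-≤-cut G irr (inj₁ (complete , _)) T (x , _) =
  contradiction (trans (sym copies) (complete _ _ distinct)) λ ()
  where
  u = quotient {order G} 2 x
  copies : adj (G ×ᴳ K₂) (combine u zero) (combine u (suc zero)) ≡ false
  copies = trans (adj-combine G K₂ u zero u (suc zero)) (cong (_∧ true) (irr u))
  distinct : combine u zero ≢ combine u (suc zero)
  distinct eq with () ← combine-injectiveʳ u zero u (suc zero) eq

theorem3p7 : (G : Graph) → IsSimple G → Connected G → ¬ IsBipartite G →
    (n : ℕ) → 6 ≤ n → 2 ∣ n →
    (k d : ℕ) → IsConnectivity (G ×ᴳ K₂) k → IsMinDegree G d →
    4 * d < n * k →
    SuperKappa (G ×ᴳ C n)
theorem3p7 G simple@(_ , irr) _ _ n′@(suc n-1@(suc _)) (s≤s (s≤s _)) _ k d κ ((v , deg-v) , d≤deg) 4d<nk S cut minimum =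
  -- The degree of `x` equals ∣S∣, which is at most every degree; this makes it minimum.
  x , (λ w → ≤-trans (≤-reflexive (cong ∣_∣ (sym S≡N))) (∣S∣≤deg w)) , S≡N
  where
  open Cycle n-1
  H = G ×ᴳ C n′

  -- Every neighbourhood is a cut, separating its centre from the copy of the same vertex of G in
  -- the next layer, so minimality of `S` applies to it.
  ∣S∣≤deg : ∀ w → ∣ S ∣ ≤ deg H w
  ∣S∣≤deg w = subst (λ w → ∣ S ∣ ≤ deg H w) (combine-remQuot {order G} n′ w)
    (minimum _ (N-product-isVertexCut G (C n′) irr (quotient {order G} n′ w) i≢i+1))
    where
    i = remainder {order G} n′ w
    i≢i+1 : i ≢ at (suc (toℕ i))
    i≢i+1 = at-distinct ≤-refl (subst (_< toℕ i + n′) (+-comm (toℕ i) 1) (+-monoʳ-< (toℕ i) (s≤s (s≤s z≤n))))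
      ∘ trans (at-toℕ i)

  ∣S∣≤2d : ∣ S ∣ ≤ d + d
  ∣S∣≤2d = begin
    ∣ S ∣                         ≤⟨ ∣S∣≤deg (combine v (at 1)) ⟩
    deg H (combine v (at 1))      ≡⟨ deg-product G (C n′) v (at 1) ⟩
    deg G v * deg (C n′) (at 1)    ≤⟨ *-mono-≤ (≤-reflexive deg-v) (deg-C≤2 0) ⟩
    d * 2                         ≡⟨ double d ⟩
    d + d                         ∎
    where
    open ≤-Reasoning
    double : ∀ d → d * 2 ≡ d + d
    double = solve-∀

  0<k : 0 < k
  0<k = n≢0⇒n>0 λ { refl → n≮0 (subst (4 * d <_) (*-zeroʳ n′) 4d<nk) }

  k≤cut : ∀ T → IsVertexCut (G ×ᴳ K₂) T → k ≤ ∣ T ∣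
  k≤cut = connectivity-≤-cut G irr κ

  -- A vertex of minimum degree in G has a neighbourhood of size `d` in G × K₂, and this is a cut.
  k≤d : k ≤ d
  k≤d = begin
    k                                    ≤⟨ k≤cut _ (N-product-isVertexCut G K₂ irr v {zero} {suc zero} (λ ())) ⟩
    deg (G ×ᴳ K₂) (combine v zero)       ≡⟨ deg-product G K₂ v zero ⟩
    deg G v * 1                          ≡⟨ trans (*-identityʳ _) deg-v ⟩
    d                                    ∎
    where open ≤-Reasoning

  2∣S∣<nk : ∣ S ∣ + ∣ S ∣ < n′ * k
  2∣S∣<nk = ≤-<-trans (≤-trans (+-mono-≤ ∣S∣≤2d ∣S∣≤2d) (≤-reflexive (quadruple d))) 4d<nk
    where
    quadruple : ∀ d → d + d + (d + d) ≡ 4 * d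
    quadruple = solve-∀

  isolated : ∃[ x ] N H x ⊆ S
  isolated = cut-isolates G simple n-1 S k d d≤deg k≤d k≤cut ∣S∣≤2d 2∣S∣<nk cut

  x = proj₁ isolated

  -- The neighbourhood lies in `S` and is at least as large as `S`.
  S≡N : S ≡ N H x
  S≡N = p⊆q∧∣q∣≤∣p∣⇒q≡p (N H x) S (proj₂ isolated) (∣S∣≤deg x)
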